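{- For every integer $n\geq 2$, the multipath complex $X(\mathtt{BL}_n)$ of the bidirectional linear digraph $\mathtt{BL}_n$ on $n+1$ vertices is not shellable.
   Context: A digraph has at most one edge $(v,w)$ from $v$ to $w$ for each ordered pair of vertices. For an edge $e=(v,w)$, $s(e)=v$ is its source and $t(e)=w$ its target. A simple path in a digraph is a sequence of edges $e_1,\dots,e_k$ with $s(e_{i+1})=t(e_i)$ for all $i<k$, such that $s(e_i)=s(e_j)$ or $t(e_i)=t(e_j)$ implies $i=j$, and which is not a cycle, i.e. $s(e_1)\neq t(e_k)$. A multipath of a digraph $G$ is a spanning subgraph each of whose connected components is either a single vertex or a simple path. The multipath complex $X(G)$ is the (abstract) simplicial complex whose simplices are the nonempty edge sets of multipaths of $G$ (the empty simplex corresponds to the multipath with no edges). The bidirectional linear digraph $\mathtt{BL}_n$ has $n+1$ vertices $v_0,\dots,v_n$ and the $2n$ edges $(v_i,v_{i+1})$ and $(v_{i+1},v_i)$ for $0\le i\le n-1$. Shellability is meant in the general (not necessarily pure) sense: a finite simplicial complex is shellable if its maximal faces can be ordered $F_1,\dots,F_k$ so that for every $2\le x\le k$ the subcomplex $\langle F_x\rangle\cap\bigcup_{i<x}\langle F_i\rangle$ is pure of dimension $\dim F_x-1$, where $\langle F\rangle$ denotes the complex of all faces of $F$. -}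

module Defs where

open import Data.Nat as ℕ using (ℕ; suc; _+_)
open import Data.Nat.Properties using (+-comm; m≢1+m+n)
open import Data.Integer using (ℤ; +_; _-_; 1ℤ)
open import Data.Fin
  using (Fin; zero; suc; toℕ; fromℕ; inject₁; splitAt; join; _<_)
open import Data.Fin.Properties
  using (inject₁-injective; toℕ-inject₁; join-splitAt)
open import Data.Fin.Subset using (Subset; _∈_; _⊆_; ∣_∣)
open import Data.Product using (_×_; ∃; ∃-syntax)
open import Data.Sum using (_⊎_; inj₁; inj₂; [_,_]′)
open import Function using (Injective; _⇔_)
open import Level using (0ℓ)
open import Relation.Binary.Construct.Closure.Equivalence using (EqClosure)
open import Relation.Binary.PropositionalEquality
  using (_≡_; _≢_; sym; trans; cong)
open import Relation.Nullary using (contradiction)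
open import Relation.Unary using (Pred; Empty; ｛_｝; _≐_; _∩_)

record Digraph : Set where
  field
    #V #E  : ℕ
    s t    : Fin #E → Fin #V
    unique : ∀ e f → s e ≡ s f → t e ≡ t f → e ≡ f

module _ (G : Digraph) where
  open Digraph G

  record Subgraph : Set₁ where
    field
      vertices : Pred (Fin #V) 0ℓ
      edges    : Pred (Fin #E) 0ℓ

  open Subgraph

  -- The path e₁, …, e_{k+1}, indexed from 0; paths have at least one edge.
  record IsSimplePath {k : ℕ} (e : Fin (suc k) → Fin #E) : Set where
    field
      linked   : ∀ (i : Fin k) → s (e (suc i)) ≡ t (e (inject₁ i))
      distinct : ∀ i j → s (e i) ≡ s (e j) ⊎ t (e i) ≡ t (e j) → i ≡ j
      acyclic  : s (e zero) ≢ t (e (fromℕ k))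

  -- A set S of edges stands for the spanning subgraph with edge set S.
  -- Connectedness ignores the direction of the edges.
  Joined : Subset #E → Fin #V → Fin #V → Set
  Joined S v w = ∃[ e ] (e ∈ S × s e ≡ v × t e ≡ w)

  Connected : Subset #E → Fin #V → Fin #V → Set
  Connected S = EqClosure (Joined S)

  component : Subset #E → Fin #V → Subgraph
  component S v .vertices w = Connected S v w
  component S v .edges    e = e ∈ S × Connected S v (s e)

  SingleVertex : Subgraph → Set
  SingleVertex H = (∃[ v ] vertices H ≐ ｛ v ｝) × Empty (edges H)

  SimplePath : Subgraph → Set
  SimplePath H = ∃[ k ] ∃ λ (e : Fin (suc k) → Fin #E) →
    IsSimplePath e ×
    edges H ≐ (λ f → ∃[ i ] e i ≡ f) ×
    vertices H ≐ (λ v → ∃[ i ] (s (e i) ≡ v ⊎ t (e i) ≡ v))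

  Multipath : Subset #E → Set
  Multipath S = ∀ v → SingleVertex (component S v) ⊎ SimplePath (component S v)

-- A complex on the ground set Fin m is given by its set of faces, the empty
-- face (of dimension -1) included.
Faces : ℕ → Set₁
Faces m = Pred (Subset m) 0ℓ

module _ {m : ℕ} where

  dim : Subset m → ℤ
  dim F = + ∣ F ∣ - 1ℤ

  ⟨_⟩ : Subset m → Faces m
  ⟨ F ⟩ G = G ⊆ F

  IsFacet : Faces m → Subset m → Set
  IsFacet X F = X F × (∀ G → X G → F ⊆ G → F ≡ G)

  PureOfDim : ℤ → Faces m → Set
  PureOfDim d X = ∀ F → IsFacet X F → dim F ≡ d

  ⋃⟨_⟩_ : ∀ {k} → (Fin k → Subset m) → Fin k → Faces m
  (⋃⟨ F ⟩ x) G = ∃[ i ] (i < x × ⟨ F i ⟩ G)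

  -- The order F is indexed from 0, so the condition is on positions x > 0.
  record IsShelling (X : Faces m) {k : ℕ} (F : Fin k → Subset m) : Set where
    field
      injective : Injective _≡_ _≡_ F
      facets    : ∀ G → IsFacet X G ⇔ (∃[ i ] F i ≡ G)
      pure      : ∀ (x : Fin k) → 0 ℕ.< toℕ x →
                  PureOfDim (dim (F x) - 1ℤ) (⟨ F x ⟩ ∩ (⋃⟨ F ⟩ x))

  Shellable : Faces m → Set
  Shellable X = ∃[ k ] ∃ λ (F : Fin k → Subset m) → IsShelling X F

X : (G : Digraph) → Faces (Digraph.#E G)
X G = Multipath G

-- The edges i ↑ˡ n are (v_i , v_{i+1}), the edges n ↑ʳ i are (v_{i+1} , v_i).
BL : ℕ → Digraph
BL n = record
  { #V     = suc n
  ; #E     = n + n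
  ; s      = λ e → src (splitAt n e)
  ; t      = λ e → tgt (splitAt n e)
  ; unique = λ e f p q → splitAt-injective e f (ends-injective _ _ p q)
  }
  where
  src tgt : Fin n ⊎ Fin n → Fin (suc n)
  src = [ inject₁ , suc ]′
  tgt = [ suc , inject₁ ]′

  opposite : ∀ {i j : Fin n} → inject₁ i ≡ suc j → suc i ≢ inject₁ j
  opposite {i} {j} p q = m≢1+m+n (toℕ i)
    (trans (trans (sym (toℕ-inject₁ i)) (cong toℕ p))
      (cong suc (trans (trans (sym (toℕ-inject₁ j)) (cong toℕ (sym q)))
        (sym (+-comm (toℕ i) 1)))))

  ends-injective : ∀ a b → src a ≡ src b → tgt a ≡ tgt b → a ≡ b
  ends-injective (inj₁ i) (inj₁ j) p q = cong inj₁ (inject₁-injective p)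
  ends-injective (inj₁ i) (inj₂ j) p q = contradiction q (opposite p)
  ends-injective (inj₂ i) (inj₁ j) p q = contradiction p (opposite q)
  ends-injective (inj₂ i) (inj₂ j) p q = cong inj₂ (inject₁-injective q)

  splitAt-injective : ∀ (e f : Fin (n + n)) → splitAt n e ≡ splitAt n f → e ≡ f
  splitAt-injective e f p = trans (sym (join-splitAt n n e))
    (trans (cong (join n n) p) (join-splitAt n n f))

{-# OPTIONS --safe #-}
-- Let A and B be the sets of all forward and of all backward edges of BL n.
-- Both are facets, and every edge e outside A cannot share a multipath with at
-- least two edges of A: the edge opposite to e and a neighbour of that edge.
-- So a facet other than A misses at least two edges of A, and its intersection
-- with A has codimension at least two in A; hence A can only come first in a
-- shelling. The same holds for B, and A ≢ B.
module Submission where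

open import Defs
open import Data.Nat using (ℕ; _≤_)
open import Relation.Nullary using (¬_)

open import Data.Fin
  using (Fin; zero; suc; toℕ; splitAt; fromℕ; inject₁; _↑ˡ_; _↑ʳ_; opposite)
open import Data.Fin.Induction using (<-weakInduction)
open import Data.Fin.Properties
  using (toℕ-injective; toℕ-inject₁; inject₁-injective; suc-injective; 0≢1+n;
         ↑ˡ-injective; ↑ʳ-injective; splitAt-↑ˡ; splitAt-↑ʳ; splitAt⁻¹-↑ˡ; splitAt⁻¹-↑ʳ;
         opposite-involutive; <-irrefl)
open import Data.Fin.Relation.Unary.Top using (view; ‵fromℕ; ‵inject₁)
open import Data.Fin.Subset
  using (Subset; _∈_; _∉_; _⊆_; _⊃_; _-_; ∣_∣; ⊤; ⊥)
open import Data.Fin.Subset.Induction using (⊃-wellFounded)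
open import Data.Fin.Subset.Properties
  using (_∈?_; ⊆-antisym; ⊥⊆; ∈⊤; ∉⊥; p⊆q⇒∣p∣≤∣q∣; x∈p⇒∣p-x∣<∣p∣;
         x∈p∧x≢y⇒x∈p-y)
import Data.Integer as ℤ
open import Data.Nat using (suc; _+_; z≤n; s≤s)
open import Data.Nat.Properties
  using (≤-<-trans; n<1+n; m<n⇒m<1+n)
import Data.Nat.Properties as ℕ
open import Data.Product using (∃-syntax; _×_; _,_; proj₁; proj₂)
open import Data.Sum using (_⊎_; inj₁; inj₂; [_,_]′)
open import Data.Vec using (_++_)
open import Data.Vec.Properties using (lookup-++ˡ; lookup-++ʳ; []=⇒lookup; lookup⇒[]=)
open import Function using (_∘_; Equivalence)
open import Induction.WellFounded using (Acc; acc)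
open import Relation.Binary.Construct.Closure.Equivalence
  using (symmetric; transitive)
open import Relation.Binary.Construct.Closure.ReflexiveTransitive using (ε; _◅_)
open import Relation.Binary.Construct.Closure.Symmetric using (fwd; bwd)
open import Relation.Binary.PropositionalEquality
  using (_≡_; _≢_; refl; sym; trans; cong; subst)
open import Relation.Nullary using (yes; no; contradiction)
open import Relation.Unary using (_∩_)

-- Facets that can only come first in a shelling.

module _ {m : ℕ} where

  -- `Y` is an arbitrary predicate, so existence is only claimed up to double negation, enough for a
  -- refutation. Without facets, induction from larger to smaller sets rules out every face: one
  -- with no face properly above it would be a facet.
  ¬¬facet : ∀ {Y : Faces m} {G} → Y G → ¬ ¬ (∃[ H ] IsFacet Y H)
  ¬¬facet {Y} YG ¬facet = noFace (⊃-wellFounded _) YG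
    where
    noFace : ∀ {G} → Acc _⊃_ G → ¬ Y G
    noFace {G} (acc rec) YG = ¬facet (G , YG , maximal)
      where
      maximal : ∀ H → Y H → G ⊆ H → G ≡ H
      maximal H YH G⊆H = ⊆-antisym G⊆H H⊆G
        where
        H⊆G : H ⊆ G
        H⊆G {e} e∈H with e ∈? G
        ... | yes e∈G = e∈G
        ... | no  e∉G = contradiction YH (noFace (rec (G⊆H , e , e∈H , e∉G)))

  -- One missed element already makes `F` a facet; two push its intersection with any other facet
  -- down to codimension at least two.
  Isolated : Faces m → Subset m → Set
  Isolated Y F = ∀ e → e ∉ F → ∃[ f ] ∃[ g ] (f ∈ F × g ∈ F × f ≢ g ×
    (∀ G → Y G → e ∈ G → f ∉ G × g ∉ G))

  isolated⇒facet : ∀ {Y F} → Y F → Isolated Y F → IsFacet Y F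
  isolated⇒facet {Y} {F} YF isolated = YF , λ G YG F⊆G →
    ⊆-antisym F⊆G (G⊆F G YG F⊆G)
    where
    G⊆F : ∀ G → Y G → F ⊆ G → G ⊆ F
    G⊆F G YG F⊆G {e} e∈G with e ∈? F
    ... | yes e∈F = e∈F
    ... | no  e∉F with f , _ , f∈F , _ , _ , miss ← isolated e e∉F =
      contradiction (F⊆G f∈F) (proj₁ (miss G YG e∈G))

  missing-two : ∀ {F H : Subset m} {f g} → H ⊆ F → f ∈ F → g ∈ F → f ≢ g →
                f ∉ H → g ∉ H → 2 + ∣ H ∣ ≤ ∣ F ∣
  missing-two {F} {H} {f} {g} H⊆F f∈F g∈F f≢g f∉H g∉H =
    ≤-<-trans (≤-<-trans (p⊆q⇒∣p∣≤∣q∣ H⊆F-f-g)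
      (x∈p⇒∣p-x∣<∣p∣ (x∈p∧x≢y⇒x∈p-y g∈F (f≢g ∘ sym)))) (x∈p⇒∣p-x∣<∣p∣ f∈F)
    where
    avoids : ∀ {e h} → h ∉ H → e ∈ H → e ≢ h
    avoids h∉H e∈H refl = h∉H e∈H

    H⊆F-f-g : H ⊆ F - f - g
    H⊆F-f-g e∈H = x∈p∧x≢y⇒x∈p-y (x∈p∧x≢y⇒x∈p-y (H⊆F e∈H) (avoids f∉H e∈H))
                                 (avoids g∉H e∈H)

  not-codim-one : ∀ {a b} → 2 + a ≤ b →
                  ℤ.+ a ℤ.- ℤ.1ℤ ≢ ℤ.+ b ℤ.- ℤ.1ℤ ℤ.- ℤ.1ℤ
  -- Once the bound is matched, both sides compute. For `a` zero the left side is -1 and the right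
  -- side is nonnegative, so that case is absent.
  not-codim-one {suc a} (s≤s (s≤s 1+a≤a)) refl = ℕ.<-irrefl refl 1+a≤a

  -- At a later position the intersection `Z` has some facet `H`, lying in an earlier `F i`. Purity
  -- makes `H` too large for `F i` to leave `F x`, so `F i` lies inside `F x`, and two facets of the
  -- list coincide.
  isolated⇒first : ∀ {Y k} {F : Fin k → Subset m} → IsShelling Y F →
                   ∀ x → Isolated Y (F x) → toℕ x ≡ 0
  isolated⇒first sh zero isolated = refl
  isolated⇒first {Y} {suc k} {F} sh x@(suc _) isolated =
    contradiction ∅-face (λ p → ¬¬facet p absurd)
    where
    open IsShelling sh

    Z : Faces m
    Z = ⟨ F x ⟩ ∩ (⋃⟨ F ⟩ x)

    ∅-face : Z ⊥
    -- Position `zero` precedes `x`, which is a successor.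
    ∅-face = ⊥⊆ , zero , s≤s z≤n , ⊥⊆

    absurd : ¬ (∃[ H ] IsFacet Z H)
    absurd (H , facet@((H⊆Fx , i , i<x , H⊆Fi) , _)) =
      <-irrefl (injective (proj₂ Fi-facet (F x) (proj₁ Fx-facet) Fi⊆Fx)) i<x
      where
      Fi-facet : IsFacet Y (F i)
      Fi-facet = Equivalence.from (facets (F i)) (i , refl)

      Fx-facet : IsFacet Y (F x)
      Fx-facet = Equivalence.from (facets (F x)) (x , refl)

      Fi⊆Fx : F i ⊆ F x
      Fi⊆Fx {e} e∈Fi with e ∈? F x
      ... | yes e∈Fx = e∈Fx
      ... | no  e∉Fx
        with f , g , f∈Fx , g∈Fx , f≢g , miss ← isolated e e∉Fx
        with f∉Fi , g∉Fi ← miss (F i) (proj₁ Fi-facet) e∈Fi =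
        contradiction (pure x (s≤s z≤n) H facet)
          (not-codim-one (missing-two H⊆Fx f∈Fx g∈Fx f≢g
            (f∉Fi ∘ H⊆Fi) (g∉Fi ∘ H⊆Fi)))

  two-isolated⇒¬shellable : ∀ {Y : Faces m} {F G} → Y F → Y G → F ≢ G →
    Isolated Y F → Isolated Y G → ¬ Shellable Y
  two-isolated⇒¬shellable YF YG F≢G isoF isoG (k , H , sh)
    with x , refl ← Equivalence.to (IsShelling.facets sh _) (isolated⇒facet YF isoF)
    with y , refl ← Equivalence.to (IsShelling.facets sh _) (isolated⇒facet YG isoG) =
    F≢G (cong H (toℕ-injective
      (trans (isolated⇒first sh x isoF) (sym (isolated⇒first sh y isoG)))))

-- Pairs of edges that exclude each other from a multipath.

module _ (G : Digraph) where
  open Digraph G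

  -- For distinct edges, the first two cases violate `distinct`, and the last is a directed 2-cycle.
  Clash : Fin #E → Fin #E → Set
  Clash e f = s e ≡ s f ⊎ t e ≡ t f ⊎ (s e ≡ t f × t e ≡ s f)

  module _ {k} {p : Fin (suc k) → Fin #E} (path : IsSimplePath G p) where
    open IsSimplePath path

    -- For `j` a successor, the edge before `p j` has the same target as `p i`, hence is `p i`. For
    -- `j` zero, the path would close up if `i` is last; otherwise the edge after `p i` shares its
    -- source with `p zero`.
    successor : ∀ i j → t (p i) ≡ s (p j) → toℕ j ≡ suc (toℕ i)
    successor i (suc j) eq
      with refl ← distinct i (inject₁ j) (inj₂ (trans eq (linked j))) =
      cong suc (sym (toℕ-inject₁ j))
    successor i zero eq with view i
    ... | ‵fromℕ     = contradiction (sym eq) acyclic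
    ... | ‵inject₁ j =
      contradiction (distinct zero (suc j) (inj₁ (trans (sym eq) (sym (linked j)))))
        0≢1+n

    path-no-clash : ∀ i j → p i ≢ p j → ¬ Clash (p i) (p j)
    path-no-clash i j i≢j (inj₁ eq)        = i≢j (cong p (distinct i j (inj₁ eq)))
    path-no-clash i j i≢j (inj₂ (inj₁ eq)) = i≢j (cong p (distinct i j (inj₂ eq)))
    -- Each edge would directly follow the other, giving `toℕ i` = 2 + `toℕ i`.
    path-no-clash i j i≢j (inj₂ (inj₂ (eq , eq′))) =
      ℕ.<-irrefl (trans (successor j i (sym eq)) (cong suc (successor i j eq′)))
        (m<n⇒m<1+n (n<1+n _))

    -- Every vertex is reached from the source of the first edge, so each component is the whole
    -- path.
    spanning-path⇒multipath : ∀ {S} → (∀ i → p i ∈ S) →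
      (∀ {e} → e ∈ S → ∃[ i ] p i ≡ e) →
      (∀ v → ∃[ i ] (s (p i) ≡ v ⊎ t (p i) ≡ v)) → Multipath G S
    spanning-path⇒multipath {S} p∈S S⊆p covers v = inj₂ (k , p , path ,
      (S⊆p ∘ proj₁ ,
        λ { (i , refl) → p∈S i , connected v (s (p i)) }) ,
      ((λ _ → covers _) , λ _ → connected v _))
      where
      step : ∀ i → Joined G S (s (p i)) (t (p i))
      step i = p i , p∈S i , refl , refl

      from-start : ∀ i → Connected G S (s (p zero)) (s (p i))
      from-start = <-weakInduction _ ε λ i c →
        transitive _ c (subst (Connected G S _) (sym (linked i)) (fwd (step _) ◅ ε))

      reached : ∀ w → Connected G S (s (p zero)) w
      reached w with covers w
      ... | i , inj₁ refl = from-start i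
      ... | i , inj₂ refl = transitive _ (from-start i) (fwd (step i) ◅ ε)

      connected : ∀ u w → Connected G S u w
      connected u w = transitive _ (symmetric _ (reached u)) (reached w)

  -- This puts both edges into one component, so that in a multipath they lie on the same simple
  -- path.
  clash⇒connected : ∀ {S e f} → e ∈ S → f ∈ S → Clash e f →
                    Connected G S (s e) (s f)
  clash⇒connected {S} {e} e∈S f∈S (inj₁ eq) = subst (Connected G S (s e)) eq ε
  clash⇒connected {f = f} e∈S f∈S (inj₂ (inj₁ eq)) =
    fwd (_ , e∈S , refl , eq) ◅ bwd (f , f∈S , refl , refl) ◅ ε
  clash⇒connected e∈S f∈S (inj₂ (inj₂ (eq , _))) =
    bwd (_ , f∈S , refl , sym eq) ◅ ε

  multipath-no-clash : ∀ {S} → Multipath G S → ∀ {e f} → e ∈ S → f ∈ S → e ≢ f →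
                       ¬ Clash e f
  multipath-no-clash mp {e} e∈S f∈S e≢f clash with mp (s e)
  ... | inj₁ (_ , noEdges) = noEdges e (e∈S , ε)
  ... | inj₂ (k , p , path , (inPath , _) , _)
    with i , refl ← inPath (e∈S , ε)
    with j , refl ← inPath (f∈S , clash⇒connected e∈S f∈S clash) =
    path-no-clash path i j e≢f clash

  clash⇒isolated : ∀ {F} →
    (∀ e → e ∉ F → ∃[ f ] ∃[ g ] (f ∈ F × g ∈ F × f ≢ g × Clash e f × Clash e g)) →
    Isolated (X G) F
  clash⇒isolated clashes e e∉F
    with f , g , f∈F , g∈F , f≢g , e↯f , e↯g ← clashes e e∉F =
    f , g , f∈F , g∈F , f≢g , λ S mp e∈S →
      (λ f∈S → multipath-no-clash mp e∈S f∈S (λ { refl → e∉F f∈F }) e↯f) ,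
      (λ g∈S → multipath-no-clash mp e∈S g∈S (λ { refl → e∉F g∈F }) e↯g)

-- Forward and backward edges of `BL n`.

module _ (n : ℕ) where
  open Digraph (BL n)

  s-forward : ∀ i → s (i ↑ˡ n) ≡ inject₁ i
  s-forward i rewrite splitAt-↑ˡ n i n = refl

  t-forward : ∀ i → t (i ↑ˡ n) ≡ suc i
  t-forward i rewrite splitAt-↑ˡ n i n = refl

  s-backward : ∀ i → s (n ↑ʳ i) ≡ suc i
  s-backward i rewrite splitAt-↑ʳ n n i = refl

  t-backward : ∀ i → t (n ↑ʳ i) ≡ inject₁ i
  t-backward i rewrite splitAt-↑ʳ n n i = refl

  forward backward : Subset (n + n)
  forward  = ⊤ {n} ++ ⊥ {n}
  backward = ⊥ {n} ++ ⊤ {n}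

  ∈-forward : ∀ i → i ↑ˡ n ∈ forward
  ∈-forward i = lookup⇒[]= _ forward
    (trans (lookup-++ˡ (⊤ {n}) (⊥ {n}) i) ([]=⇒lookup (∈⊤ {n} {i})))

  ∈-backward : ∀ i → n ↑ʳ i ∈ backward
  ∈-backward i = lookup⇒[]= _ backward
    (trans (lookup-++ʳ (⊥ {n}) (⊤ {n}) i) ([]=⇒lookup (∈⊤ {n} {i})))

  ∉-forward : ∀ i → n ↑ʳ i ∉ forward
  ∉-forward i i∈ = ∉⊥ (lookup⇒[]= i ⊥
    (trans (sym (lookup-++ʳ (⊤ {n}) (⊥ {n}) i)) ([]=⇒lookup i∈)))

  ∉-backward : ∀ i → i ↑ˡ n ∉ backward
  ∉-backward i i∈ = ∉⊥ (lookup⇒[]= i ⊥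
    (trans (sym (lookup-++ˡ (⊥ {n}) (⊤ {n}) i)) ([]=⇒lookup i∈)))

  -- A view: matching on it brings an edge into the form to which the endpoint equations apply.
  data Direction : Fin (n + n) → Set where
    fwdEdge : ∀ i → Direction (i ↑ˡ n)
    bwdEdge : ∀ i → Direction (n ↑ʳ i)

  direction : ∀ e → Direction e
  direction e with splitAt n e in eq
  ... | inj₁ i = subst Direction (splitAt⁻¹-↑ˡ eq) (fwdEdge i)
  ... | inj₂ i = subst Direction (splitAt⁻¹-↑ʳ {n} eq) (bwdEdge i)

  forward⊆ : ∀ {e} → e ∈ forward → ∃[ i ] i ↑ˡ n ≡ e
  forward⊆ {e} e∈ with direction e
  ... | fwdEdge i = i , refl
  ... | bwdEdge i = contradiction e∈ (∉-forward i)

  backward⊆ : ∀ {e} → e ∈ backward → ∃[ i ] n ↑ʳ i ≡ e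
  backward⊆ {e} e∈ with direction e
  ... | fwdEdge i = contradiction e∈ (∉-backward i)
  ... | bwdEdge i = i , refl

-- The two directed spanning paths.

module _ (n : ℕ) where
  open Digraph (BL (suc n))

  private
    N = suc n

  -- The backward path starts at the last vertex, so its edges are traversed in
  -- decreasing order of index.
  back : Fin N → Fin (N + N)
  back i = N ↑ʳ opposite i

  forward-path : IsSimplePath (BL N) (_↑ˡ N)
  forward-path = record
    { linked   = λ i → trans (s-forward N (suc i)) (sym (t-forward N (inject₁ i)))
    ; distinct = λ where
        i j (inj₁ eq) → inject₁-injective
          (trans (sym (s-forward N i)) (trans eq (s-forward N j)))
        i j (inj₂ eq) → suc-injective
          (trans (sym (t-forward N i)) (trans eq (t-forward N j)))
    ; acyclic  = λ eq → 0≢1+n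
        (trans (sym (s-forward N zero)) (trans eq (t-forward N (fromℕ n))))
    }

  opposite-inject₁ : ∀ {m} (i : Fin m) → opposite (inject₁ i) ≡ suc (opposite i)
  opposite-inject₁ zero    = refl
  opposite-inject₁ (suc i) = cong inject₁ (opposite-inject₁ i)

  opposite-injective : ∀ {m} {i j : Fin m} → opposite i ≡ opposite j → i ≡ j
  opposite-injective eq =
    trans (sym (opposite-involutive _)) (trans (cong opposite eq) (opposite-involutive _))

  backward-path : IsSimplePath (BL N) back
  backward-path = record
    { linked   = λ i → trans (s-backward N (opposite (suc i)))
        (sym (trans (t-backward N (opposite (inject₁ i)))
          (cong inject₁ (opposite-inject₁ i))))
    ; distinct = λ where
        i j (inj₁ eq) → opposite-injective (suc-injective
          (trans (sym (s-backward N (opposite i))) (trans eq (s-backward N (opposite j)))))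
        i j (inj₂ eq) → opposite-injective (inject₁-injective
          (trans (sym (t-backward N (opposite i))) (trans eq (t-backward N (opposite j)))))
    ; acyclic  = λ eq → 0≢1+n (sym
        (trans (sym (s-backward N (opposite zero)))
          (trans eq (trans (t-backward N (opposite (fromℕ n)))
            -- `fromℕ n` is `opposite zero` by computation, so the last backward edge has index
            -- `zero` and ends at the first vertex.
            (cong inject₁ (opposite-involutive {N} zero))))))
    }

  forward-multipath : X (BL N) (forward N)
  forward-multipath = spanning-path⇒multipath (BL N) forward-path
    (∈-forward N) (forward⊆ N) λ where
      zero    → zero , inj₁ (s-forward N zero)
      (suc i) → i , inj₂ (t-forward N i)

  backward-multipath : X (BL N) (backward N)
  backward-multipath = spanning-path⇒multipath (BL N) backward-path
    (∈-backward N ∘ opposite) ⊆back covers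
    where
    N↑ʳ≡back : ∀ i → back (opposite i) ≡ N ↑ʳ i
    N↑ʳ≡back i = cong (N ↑ʳ_) (opposite-involutive i)

    ⊆back : ∀ {e} → e ∈ backward N → ∃[ i ] back i ≡ e
    ⊆back e∈ with i , refl ← backward⊆ N e∈ = opposite i , N↑ʳ≡back i

    covers : ∀ v → ∃[ i ] (s (back i) ≡ v ⊎ t (back i) ≡ v)
    covers zero    = opposite zero ,
      inj₂ (trans (cong t (N↑ʳ≡back zero)) (t-backward N zero))
    covers (suc i) = opposite i ,
      inj₁ (trans (cong s (N↑ʳ≡back i)) (s-backward N i))

-- Isolation of the two paths.

-- Here the bound 2 on the length enters: with two or more positions, `zero` has a next one and
-- every other position a previous one.
adjacent : ∀ {n} (i : Fin (2 + n)) →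
           ∃[ j ] (i ≢ j × (suc i ≡ inject₁ j ⊎ inject₁ i ≡ suc j))
adjacent zero    = suc zero , (λ ()) , inj₁ refl
adjacent (suc i) = inject₁ i , suc≢inject₁ , inj₂ refl
  where
  suc≢inject₁ : suc i ≢ inject₁ i
  suc≢inject₁ eq = ℕ.1+n≢n (trans (cong toℕ eq) (toℕ-inject₁ i))

module _ (n : ℕ) where
  private
    N = 2 + n
  open Digraph (BL N)

  forward-isolated : Isolated (X (BL N)) (forward N)
  forward-isolated = clash⇒isolated (BL N) clashes
    where
    clashes : ∀ e → e ∉ forward N → ∃[ f ] ∃[ g ]
      (f ∈ forward N × g ∈ forward N × f ≢ g × Clash (BL N) e f × Clash (BL N) e g)
    clashes e e∉ with direction N e
    ... | fwdEdge i = contradiction (∈-forward N i) e∉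
    ... | bwdEdge i with j , i≢j , adj ← adjacent i =
      i ↑ˡ N , j ↑ˡ N , ∈-forward N i , ∈-forward N j ,
      i≢j ∘ ↑ˡ-injective N i j ,
      inj₂ (inj₂ (trans (s-backward N i) (sym (t-forward N i)) ,
                  trans (t-backward N i) (sym (s-forward N i)))) ,
      -- If `j` comes next after `i`, both edges leave their common vertex; if it comes just before,
      -- both enter it.
      [ (λ eq → inj₁ (trans (s-backward N i) (trans eq (sym (s-forward N j)))))
      , (λ eq → inj₂ (inj₁ (trans (t-backward N i) (trans eq (sym (t-forward N j))))))
      ]′ adj

  backward-isolated : Isolated (X (BL N)) (backward N)
  backward-isolated = clash⇒isolated (BL N) clashes
    where
    clashes : ∀ e → e ∉ backward N → ∃[ f ] ∃[ g ]
      (f ∈ backward N × g ∈ backward N × f ≢ g × Clash (BL N) e f × Clash (BL N) e g)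
    clashes e e∉ with direction N e
    ... | bwdEdge i = contradiction (∈-backward N i) e∉
    ... | fwdEdge i with j , i≢j , adj ← adjacent i =
      N ↑ʳ i , N ↑ʳ j , ∈-backward N i , ∈-backward N j ,
      i≢j ∘ ↑ʳ-injective N i j ,
      inj₂ (inj₂ (trans (s-forward N i) (sym (t-backward N i)) ,
                  trans (t-forward N i) (sym (s-backward N i)))) ,
      -- With directions reversed, both edges enter the common vertex when `j` comes next, and leave
      -- it otherwise.
      [ (λ eq → inj₂ (inj₁ (trans (t-forward N i) (trans eq (sym (t-backward N j))))))
      , (λ eq → inj₁ (trans (s-forward N i) (trans eq (sym (s-backward N j)))))
      ]′ adj

proposition3p2 : (n : ℕ) → 2 ≤ n → ¬ Shellable (X (BL n))
proposition3p2 (suc (suc n)) (s≤s (s≤s z≤n)) = two-isolated⇒¬shellable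
  -- The two sets already differ, by computation, at their first entry.
  (forward-multipath (suc n)) (backward-multipath (suc n)) (λ ())
  (forward-isolated n) (backward-isolated n)
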